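{- Let $G$ be a balanced Multicolored Clique instance: a $k$-partite graph with color classes $V(G)=V_1\uplus\cdots\uplus V_k$, $|V_i|=q$ for all $i$. Let $p=kq$ and let $\{H_\lambda\}_{\lambda\in V(G)}$ be the label graphs on the vertex set $Z$ constructed from $G$ as in the context. Let $b=p-k$. Form an edge-labeled multigraph on $Z$ by assigning label $\lambda$ to every edge of $H_\lambda$ and taking all these edges together; if different label graphs use an edge on the same unordered pair of vertices, retain them as parallel edges with different labels. The resulting Global Label Min-Cut instance with budget $b$ is a Yes-instance if and only if the original balanced Multicolored Clique instance $G$ is a Yes-instance.
   Context: Global Label Min-Cut: given an undirected multigraph with vertex set $V$, edge set $E$, a labeling $\chi$ of $E$ by a set of $p$ labels, and a budget $b\in\{0,\dots,p\}$, decide whether there is $\varnothing\neq S\subsetneq V$ such that at most $b$ distinct labels occur on the edges with exactly one endpoint in $S$. Multicolored Clique: $G$ is a Yes-instance iff there exist $x_i\in V_i$ ($i=1,\dots,k$) such that $\{x_1,\dots,x_k\}$ is a clique. $\mathrm{Part}(W)$ is the set of partitions of the finite set $W$ ordered by refinement; joins $\vee$ are taken in this lattice. For a graph $H$ on vertex set $W$ (isolated vertices allowed), $\mathrm{cc}(H)$ is the partition of $W$ into connected components of $H$. $[m]=\{1,\dots,m\}$; $k,q\ge1$. Labels: each vertex $u\in V_i$ is a label $\lambda=(i,u)$; fix a bijection of each $V_i$ with $[q]$, so that $u\in V_i$ corresponds to an index $a(u)\in[q]$. Selection-validity partitions. Let $M_0=\max\{q,2^k\}$, let $\ell$ be a prime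 with $M_0<\ell<2M_0$, let $\alpha_1,\dots,\alpha_q\in\mathbb Z_\ell$ be pairwise distinct, and $X=\{\bot\}\cup(2^{[k]}\times\mathbb Z_\ell)$ with basepoint $\bot$. For $\lambda=(i,u)$ with $a=a(u)$, $J_\lambda$ is the graph on $X$ with exactly the edges $\bot(S,0)$ for all $S\subseteq[k]$, and $(S,t)(S\cup\{i\},t+\alpha_a)$ for all $S\subseteq[k]\setminus\{i\}$, $t\in\mathbb Z_\ell$. Put $E_\lambda=\mathrm{cc}(J_\lambda)$. Clique-consistency partitions. Let $Y=\{s,t\}\cup\{z_{uv}:u\in V_i,\ v\in V_j,\ i<j,\ uv\notin E(G)\}$ with basepoint $s$. The graphs $Q_{i,u}$ on $Y$ ($u\in V_i$) have exactly the edges given by: for each nonedge $uv$ with $u\in V_i$, $v\in V_j$, $i<j$: add $sz_{uv}$ to $Q_{i,u}$; add $z_{uv}t$ to $Q_{j,v}$; add $sz_{uv}$ to $Q_{j,w}$ for every $w\in V_j\setminus\{v\}$. Put $R_\lambda=\mathrm{cc}(Q_\lambda)$. Combination. For pointed finite sets $(X,x_0)$, $(Y,y_0)$ (here $x_0=\bot$, $y_0=s$) let $X^\circ=X\setminus\{x_0\}$, $Y^\circ=Y\setminus\{y_0\}$ and $Z=\{z_0\}\cup(X^\circ\times Y^\circ)$ with $z_0$ a new point. For $\alpha\in\mathrm{Part}(X)$ with $A_0$ the block of $x_0$, $L_X(\alpha)\in\mathrm{Part}(Z)$ has blocks $\{z_0\}\cup((A_0\setminus\{x_0\})\times Y^\circ)$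 and $A\times\{y\}$ for all blocks $A\ne A_0$ of $\alpha$ and $y\in Y^\circ$; $L_Y(\beta)$ for $\beta\in\mathrm{Part}(Y)$, with $B_0$ the block of $y_0$, has blocks $\{z_0\}\cup(X^\circ\times(B_0\setminus\{y_0\}))$ and $\{x\}\times B$ for all blocks $B\neq B_0$ of $\beta$ and $x\in X^\circ$. Define $P_\lambda=L_X(E_\lambda)\vee L_Y(R_\lambda)$, and let $H_\lambda$ be the graph on $Z$ obtained by choosing a spanning tree inside every block of $P_\lambda$ (and no other edges), so $\mathrm{cc}(H_\lambda)=P_\lambda$. -}

module Defs where

open import Data.Bool.Base using (Bool; true; false)
open import Data.Empty using (⊥-elim; ⊥-elim-irr)
open import Data.Fin.Base as Fin using (Fin)
open import Data.Fin.Properties as Fin using (*↔×)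
open import Data.Fin.Subset using (Subset; _∪_; ⁅_⁆; _∉_)
open import Data.List.Base as List
  using (List; []; _∷_; [_]; length; map; concatMap; cartesianProduct; cartesianProductWith; allFin)
open import Data.List.Membership.Propositional using (_∈_; lose)
open import Data.List.Membership.Propositional.Properties
  using (∈-map⁺; ∈-concatMap⁺; ∈-cartesianProduct⁺; ∈-cartesianProductWith⁺; ∈-allFin)
open import Data.List.Relation.Unary.All using (All)
open import Data.List.Relation.Unary.Any using (here; there)
open import Data.List.Relation.Unary.Enumerates.Setoid using (IsEnumeration)
open import Data.List.Relation.Unary.Unique.Propositional using (Unique)
open import Data.Maybe.Base using (Maybe; nothing; just)
open import Data.Nat.Base as ℕ using (ℕ; NonZero; _≤_; _∸_)
open import Data.Nat.DivMod using (_mod_)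
open import Data.Nat.Properties using (m∸n≤m)
open import Data.Product.Base using (Σ; Σ-syntax; ∃-syntax; _×_; _,_; proj₁; proj₂)
import Data.Product.Function.Dependent.Propositional as Σ
open import Data.Sum.Base using (inj₁; inj₂)
open import Data.Unit.Base using (⊤; tt)
import Data.Vec.Base as Vec
open import Function.Bundles using (_↔_; _⇔_; mk⇔; Inverse)
open import Function.Properties.Inverse using (↔-refl; ↔-sym; ↔-trans)
open import Level using (0ℓ)
open import Relation.Binary.Core using (Rel; _⇒_)
open import Relation.Binary.Construct.Closure.Equivalence using (EqClosure)
import Relation.Binary.Construct.Closure.Equivalence as EqC
open import Relation.Binary.Construct.Closure.ReflexiveTransitive using (ε; _◅_)
open import Relation.Binary.Construct.Closure.Symmetric using (fwd; bwd)
import Relation.Binary.Construct.Union as Union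
open import Relation.Binary.Definitions using (Decidable; Symmetric)
open import Relation.Binary.Lattice.Definitions using (Supremum)
open import Relation.Binary.PropositionalEquality
  using (_≡_; _≢_; refl; subst; setoid)
open import Relation.Binary.Structures using (IsEquivalence)
open import Relation.Nullary using (¬_; yes; no)
open import Relation.Nullary.Decidable using (_×-dec_; ¬?)

Finite : Set → Set
Finite A = Σ[ xs ∈ List A ] IsEnumeration (setoid A) xs

-- Undirected multigraphs.  The order of the two endpoints returned by
-- `ends` carries no meaning: every notion below is invariant under
-- swapping them.
record Graph (W : Set) : Set₁ where
  field
    Edge : Set
    ends : Edge → W × W

module _ {W : Set} (H : Graph W) where
  open Graph H

  Joins : Rel W 0ℓ
  Joins u v = Σ[ e ∈ Edge ] ends e ≡ (u , v)

  -- Finite walks, traversing edges in either direction.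
  Walk : Rel W 0ℓ
  Walk = EqClosure Joins

module _ {W : Set} {H : Graph W} where
  open Graph H

  edges : ∀ {u v} → Walk H u v → List Edge
  edges ε                 = []
  edges (fwd (e , _) ◅ w) = e ∷ edges w
  edges (bwd (e , _) ◅ w) = e ∷ edges w

  -- All visited vertices except the final one, so that a closed walk
  -- lists its starting point once.
  vertices : ∀ {u v} → Walk H u v → List W
  vertices ε             = []
  vertices {u} (_ ◅ w)   = u ∷ vertices w

  -- A loop is a cycle of length 1 and two parallel edges form a cycle
  -- of length 2; in particular acyclic graphs are simple.
  IsCycle : ∀ {v} → Walk H v v → Set
  IsCycle c = edges c ≢ [] × Unique (edges c) × Unique (vertices c)

Acyclic : ∀ {W} → Graph W → Set
Acyclic {W} H = ∀ {v : W} (c : Walk H v v) → ¬ IsCycle c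

-- A partition is given by the relation "being in the same block".
record Partition (W : Set) : Set₁ where
  field
    _~_           : Rel W 0ℓ
    isEquivalence : IsEquivalence _~_

  open IsEquivalence isEquivalence public
    renaming (refl to ~-refl; sym to ~-sym; trans to ~-trans)
    using ()

module _ {W : Set} where

  Same : Partition W → Rel W 0ℓ
  Same = Partition._~_

  infix 4 _⊑_
  _⊑_ : Rel (Partition W) 0ℓ
  P ⊑ Q = ∀ {u v} → Same P u v → Same Q u v

  infixr 6 _∨_
  _∨_ : Partition W → Partition W → Partition W
  P ∨ Q = record
    { _~_           = EqClosure (Same P Union.∪ Same Q)
    ; isEquivalence = EqC.isEquivalence _
    }

  ∨-supremum : Supremum _⊑_ _∨_
  ∨-supremum P Q = (λ p → fwd (inj₁ p) ◅ ε) , (λ q → fwd (inj₂ q) ◅ ε) , least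
    where
    least : ∀ R → P ⊑ R → Q ⊑ R → P ∨ Q ⊑ R
    least R P⊑R Q⊑R = go
      where
      open Partition R
      step : Same P Union.∪ Same Q ⇒ Same R
      step (inj₁ p) = P⊑R p
      step (inj₂ q) = Q⊑R q
      go : EqClosure (Same P Union.∪ Same Q) ⇒ Same R
      go ε           = ~-refl
      go (fwd r ◅ w) = ~-trans (step r) (go w)
      go (bwd r ◅ w) = ~-trans (~-sym (step r)) (go w)

cc : ∀ {W} → Graph W → Partition W
cc H = record { _~_ = Walk H ; isEquivalence = EqC.isEquivalence (Joins H) }

-- A spanning tree inside every block of P and no other edges.  Edges
-- never leave a block, so the walks in `connected` stay in their block.
record SpanningForest {W : Set} (P : Partition W) : Set₁ where
  field
    graph     : Graph W
  open Graph graph public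
  field
    finite    : Finite Edge
    within    : ∀ e → Same P (proj₁ (ends e)) (proj₂ (ends e))
    connected : ∀ {u v} → Same P u v → Walk graph u v
    acyclic   : Acyclic graph

record GlobalLabelMinCut : Set₁ where
  field
    Vertex        : Set
    vertex-finite : Finite Vertex
    graph         : Graph Vertex
  open Graph graph public
  field
    edge-finite   : Finite Edge
    p             : ℕ
    Label         : Set
    labels        : Label ↔ Fin p
    χ             : Edge → Label
    b             : ℕ
    b≤p           : b ≤ p

-- Cardinality bound for the set of elements satisfying P, stated so that
-- P need not be decidable.
AtMost : {A : Set} → ℕ → (A → Set) → Set
AtMost n P = ∀ xs → Unique xs → All P xs → length xs ≤ n

module _ (I : GlobalLabelMinCut) where
  open GlobalLabelMinCut I

  Cuts : (Vertex → Bool) → Edge → Set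
  Cuts S e = S (proj₁ (ends e)) ≢ S (proj₂ (ends e))

  OccursOnCut : (Vertex → Bool) → Label → Set
  OccursOnCut S l = Σ[ e ∈ Edge ] χ e ≡ l × Cuts S e

  IsYesCut : Set
  IsYesCut = Σ[ S ∈ (Vertex → Bool) ]
    (∃[ v ] S v ≡ true) × (∃[ v ] S v ≡ false) × AtMost b (OccursOnCut S)

-- Includes the fixed bijections of the colour classes with [q].
record BalancedMulticolored (k q : ℕ) : Set₁ where
  field
    V        : Fin k → Set
    index    : ∀ i → V i ↔ Fin q

  Vertex : Set
  Vertex = Σ (Fin k) V

  field
    Adj      : Rel Vertex 0ℓ
    adj?     : Decidable Adj
    adj-sym  : Symmetric Adj
    partite  : ∀ {u v} → Adj u v → proj₁ u ≢ proj₁ v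

  colour : Vertex → Fin k
  colour = proj₁

  a : Vertex → Fin q
  a (i , u) = Inverse.to (index i) u

IsYesClique : ∀ {k q} → BalancedMulticolored k q → Set
IsYesClique {k} G = Σ[ x ∈ (∀ i → V i) ] (∀ i j → i ≢ j → Adj (i , x i) (j , x j))
  where open BalancedMulticolored G

-- A pointed set is presented as `Maybe A`, with basepoint `nothing` and
-- `A` the set of the other points.  Thus Z is `Maybe (A × B)`.
module _ {A B : Set} where

  -- Membership in the block of z₀.
  BaseX : Partition (Maybe A) → Maybe (A × B) → Set
  BaseX α nothing        = ⊤
  BaseX α (just (x , _)) = Same α (just x) nothing

  BaseY : Partition (Maybe B) → Maybe (A × B) → Set
  BaseY β nothing        = ⊤
  BaseY β (just (_ , y)) = Same β (just y) nothing

  -- `copy` also applies to the block A₀, where it adds nothing to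
  -- `base`; see `LX-base` and `LX-copy` for the resulting blocks.
  data SameLX (α : Partition (Maybe A)) : Rel (Maybe (A × B)) 0ℓ where
    base : ∀ {z z′} → BaseX α z → BaseX α z′ → SameLX α z z′
    copy : ∀ {x x′ y} → Same α (just x) (just x′) → SameLX α (just (x , y)) (just (x′ , y))

  data SameLY (β : Partition (Maybe B)) : Rel (Maybe (A × B)) 0ℓ where
    base : ∀ {z z′} → BaseY β z → BaseY β z′ → SameLY β z z′
    copy : ∀ {x y y′} → Same β (just y) (just y′) → SameLY β (just (x , y)) (just (x , y′))

  LX : Partition (Maybe A) → Partition (Maybe (A × B))
  LX α = record
    { _~_           = SameLX α
    ; isEquivalence = record
      { refl  = λ { {nothing} → base tt tt ; {just _} → copy ~-refl }
      ; sym   = λ { (base p q) → base q p ; (copy r) → copy (~-sym r) }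
      ; trans = trans′
      }
    }
    where
    open Partition α
    trans′ : ∀ {z z′ z″} → SameLX α z z′ → SameLX α z′ z″ → SameLX α z z″
    trans′ (base p _) (base _ q) = base p q
    trans′ (base p q) (copy r)   = base p (~-trans (~-sym r) q)
    trans′ (copy r)   (base p q) = base (~-trans r p) q
    trans′ (copy r)   (copy r′)  = copy (~-trans r r′)

  LY : Partition (Maybe B) → Partition (Maybe (A × B))
  LY β = record
    { _~_           = SameLY β
    ; isEquivalence = record
      { refl  = λ { {nothing} → base tt tt ; {just _} → copy ~-refl }
      ; sym   = λ { (base p q) → base q p ; (copy r) → copy (~-sym r) }
      ; trans = trans′
      }
    }
    where
    open Partition β
    trans′ : ∀ {z z′ z″} → SameLY β z z′ → SameLY β z′ z″ → SameLY β z z″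
    trans′ (base p _) (base _ q) = base p q
    trans′ (base p q) (copy r)   = base p (~-trans (~-sym r) q)
    trans′ (copy r)   (base p q) = base (~-trans r p) q
    trans′ (copy r)   (copy r′)  = copy (~-trans r r′)

  LX-base : ∀ α {z} → Same (LX α) nothing z ⇔ BaseX α z
  LX-base α = mk⇔ (λ { (base _ q) → q }) (base tt)

  LX-copy : ∀ α {x y z} → ¬ Same α (just x) nothing →
            Same (LX α) (just (x , y)) z ⇔
            (∃[ x′ ] z ≡ just (x′ , y) × Same α (just x) (just x′))
  LX-copy α x∉A₀ = mk⇔
    (λ { (base p _) → ⊥-elim (x∉A₀ p) ; (copy r) → _ , refl , r })
    (λ { (_ , refl , r) → copy r })

  LY-base : ∀ β {z} → Same (LY β) nothing z ⇔ BaseY β z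
  LY-base β = mk⇔ (λ { (base _ q) → q }) (base tt)

  LY-copy : ∀ β {x y z} → ¬ Same β (just y) nothing →
            Same (LY β) (just (x , y)) z ⇔
            (∃[ y′ ] z ≡ just (x , y′) × Same β (just y) (just y′))
  LY-copy β y∉B₀ = mk⇔
    (λ { (base p _) → ⊥-elim (y∉B₀ p) ; (copy r) → _ , refl , r })
    (λ { (_ , refl , r) → copy r })

module Construction {k q : ℕ} (G : BalancedMulticolored k q)
                    (ℓ : ℕ) .{{_ : NonZero ℓ}} (α : Fin q → Fin ℓ) where
  open BalancedMulticolored G

  -- ℤ_ℓ is `Fin ℓ`.
  0ₗ : Fin ℓ
  0ₗ = 0 mod ℓ

  infixl 6 _+ₗ_
  _+ₗ_ : Fin ℓ → Fin ℓ → Fin ℓ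
  s +ₗ t = (Fin.toℕ s ℕ.+ Fin.toℕ t) mod ℓ

  -- The basepoint ⊥ of X is `nothing`.
  X° X : Set
  X° = Subset k × Fin ℓ
  X  = Maybe X°

  data JEdge (l : Vertex) : Set where
    spoke : Subset k → JEdge l
    step  : (S : Subset k) → .(colour l ∉ S) → Fin ℓ → JEdge l

  J : Vertex → Graph X
  J l = record
    { Edge = JEdge l
    ; ends = λ where
        (spoke S)    → nothing , just (S , 0ₗ)
        (step S _ t) → just (S , t) , just (S ∪ ⁅ colour l ⁆ , t +ₗ α (a l))
    }

  E : Vertex → Partition X
  E l = cc (J l)

  -- The proofs are irrelevant so that z_uv is determined by u and v.
  record NonEdge : Set where
    constructor nonEdge
    field
      u v      : Vertex
      .ordered : colour u Fin.< colour v
      .nonadj  : ¬ Adj u v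

  -- The basepoint s of Y is `nothing`.
  data Y° : Set where
    t : Y°
    z : NonEdge → Y°

  Y : Set
  Y = Maybe Y°

  data QEdge (l : Vertex) : Set where
    first  : (n : NonEdge) → NonEdge.u n ≡ l → QEdge l
    second : (n : NonEdge) → NonEdge.v n ≡ l → QEdge l
    other  : (n : NonEdge) → colour (NonEdge.v n) ≡ colour l → NonEdge.v n ≢ l → QEdge l

  Q : Vertex → Graph Y
  Q l = record
    { Edge = QEdge l
    ; ends = λ where
        (first n _)   → nothing , just (z n)
        (second n _)  → just (z n) , just t
        (other n _ _) → nothing , just (z n)
    }

  R : Vertex → Partition Y
  R l = cc (Q l)

  Z : Set
  Z = Maybe (X° × Y°)

  P : Vertex → Partition Z
  P l = LX (E l) ∨ LY (R l)

  vertex↔ : Vertex ↔ Fin (k ℕ.* q)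
  vertex↔ = ↔-trans (Σ.cong ↔-refl (λ {i} → index i)) (↔-sym *↔×)

  vertex-finite : Finite Vertex
  vertex-finite = map from (allFin _) , λ v →
    subst (_∈ _) (strictlyInverseʳ v) (∈-map⁺ from (∈-allFin (to v)))
    where open Inverse vertex↔

  subset-finite : ∀ n → Finite (Subset n)
  subset-finite ℕ.zero    = [ Vec.[] ] , λ { Vec.[] → here refl }
  subset-finite (ℕ.suc n) =
    cartesianProductWith Vec._∷_ sides (proj₁ (subset-finite n)) , λ where
      (s Vec.∷ S) → ∈-cartesianProductWith⁺ Vec._∷_ (∈sides s) (proj₂ (subset-finite n) S)
    where
    sides : List Bool
    sides = true ∷ false ∷ []
    ∈sides : ∀ s → s ∈ sides
    ∈sides true  = here refl
    ∈sides false = there (here refl)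

  nonEdge-finite : Finite NonEdge
  nonEdge-finite = concatMap pick pairs , λ where
      n@(nonEdge u v _ _) → ∈-concatMap⁺ pick
        (lose (∈-cartesianProduct⁺ (proj₂ vertex-finite u) (proj₂ vertex-finite v)) (picked n))
    where
    pairs : List (Vertex × Vertex)
    pairs = cartesianProduct (proj₁ vertex-finite) (proj₁ vertex-finite)
    pick : Vertex × Vertex → List NonEdge
    pick (u , v) with (colour u Fin.<? colour v) ×-dec ¬? (adj? u v)
    ... | yes (p , q) = [ nonEdge u v p q ]
    ... | no _        = []
    picked : ∀ n → n ∈ pick (NonEdge.u n , NonEdge.v n)
    picked (nonEdge u v p q) with (colour u Fin.<? colour v) ×-dec ¬? (adj? u v)
    ... | yes _ = here refl
    ... | no ¬d = ⊥-elim-irr (¬d (p , q))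

  Z-finite : Finite Z
  Z-finite = nothing ∷ map just (cartesianProduct xs ys) , λ where
      nothing        → here refl
      (just (x , y)) → there (∈-map⁺ just (∈-cartesianProduct⁺ (∈xs x) (∈ys y)))
    where
    xs : List X°
    xs = cartesianProduct (proj₁ (subset-finite k)) (allFin ℓ)
    ∈xs : ∀ x → x ∈ xs
    ∈xs (S , c) = ∈-cartesianProduct⁺ (proj₂ (subset-finite k) S) (∈-allFin c)
    ys : List Y°
    ys = t ∷ map z (proj₁ nonEdge-finite)
    ∈ys : ∀ y → y ∈ ys
    ∈ys t     = here refl
    ∈ys (z n) = there (∈-map⁺ z (proj₂ nonEdge-finite n))

  -- The edge set is the disjoint union of the edge sets of the label
  -- graphs, so edges of different labels on the same pair stay parallel.
  instanceOf : (∀ l → SpanningForest (P l)) → GlobalLabelMinCut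
  instanceOf H = record
    { Vertex        = Z
    ; vertex-finite = Z-finite
    ; graph         = record
      { Edge = Σ[ l ∈ Vertex ] SpanningForest.Edge (H l)
      ; ends = λ { (l , e) → SpanningForest.ends (H l) e }
      }
    ; edge-finite   = concatMap es (proj₁ vertex-finite) , λ where
        (l , e) → ∈-concatMap⁺ es
          (lose (proj₂ vertex-finite l) (∈-map⁺ (l ,_) (proj₂ (SpanningForest.finite (H l)) e)))
    ; p             = k ℕ.* q
    ; Label         = Vertex
    ; labels        = vertex↔
    ; χ             = proj₁
    ; b             = k ℕ.* q ∸ k
    ; b≤p           = m∸n≤m (k ℕ.* q) k
    }
    where
    es : ∀ l → List (Σ[ l ∈ Vertex ] SpanningForest.Edge (H l))
    es l = map (l ,_) (proj₁ (SpanningForest.finite (H l)))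

{-# OPTIONS --safe #-}
-- A label misses a cut S exactly when S is constant on the blocks of P_λ,
-- i.e. on those of L_X(E_λ) and of L_Y(R_λ).
--
-- A cut of Z missed by k labels: at a point (x , y) where S differs from S z₀,
-- restrict S to the slices X ∧ y and x ∧ Y.  Two missed labels of one colour
-- would make the X-slice constant, because all translates by the nonzero
-- difference of their shifts generate ℤ_ℓ; so the missed labels are one per
-- colour.  A nonadjacent pair u, v among them would make the Y-slice constant,
-- through the path s – z_uv – t.
--
-- A clique x: along the selected labels, (S , r) ↦ r − Σ_{i ∈ S} α(x_i) is
-- invariant, and as 2ᵏ < ℓ some value c is not taken on the block of ⊥.  The
-- product of the level set of c with {t} ∪ {z_uv : v selected} is a cut missed
-- by all selected labels.
module Submission where

open import Defs
open import Data.Bool.Base using (Bool; true; false; _∧_)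
open import Data.Bool.Properties using (∧-zeroʳ; ∨-identityʳ)
  renaming (_≟_ to _≟ᵇ_)
open import Data.Empty using (⊥-elim-irr)
open import Data.Fin.Base as Fin using (Fin; toℕ; zero; suc; combine)
open import Data.Fin.Properties as Fin
  using (_≟_; toℕ<n; toℕ-injective; toℕ-fromℕ<; combine-injective; injective⇒≤; ¬∀⟶∃¬; 2↔Bool)
open import Data.Fin.Subset using (Subset; inside; outside; _∪_; ⁅_⁆; _∈_; _∉_)
  renaming (⊥ to ∅)
open import Data.Fin.Subset.Properties using (_∈?_; ∪-identityʳ; anySubset?)
open import Data.List.Base using (List; []; _∷_; length; map; _++_; filter; allFin; lookup)
open import Data.List.Membership.Propositional using (lose) renaming (_∈_ to _∈ₗ_)
import Data.List.Membership.DecPropositional as DecMembership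
open import Data.List.Membership.Propositional.Properties
  using (∈-map⁻; ∈-filter⁺; ∈-filter⁻; ∈-++⁺ˡ; ∈-++⁺ʳ; ∈-lookup; ∈-allFin)
open import Data.List.Properties using (length-map; length-++; length-tabulate)
open import Data.List.Relation.Binary.Subset.Propositional using (_⊆_)
open import Data.List.Relation.Unary.All as All using (All; []; _∷_)
open import Data.List.Relation.Unary.All.Properties using (¬Any⇒All¬; all-filter)
  renaming (map⁺ to All-map⁺)
open import Data.List.Relation.Unary.AllPairs using ([]; _∷_)
open import Data.List.Relation.Unary.Any as Any using (Any; here; there; any?; satisfied)
open import Data.List.Relation.Unary.Any.Properties using (lookup-index)
open import Data.List.Relation.Unary.Unique.Propositional using (Unique)
import Data.List.Relation.Unary.Unique.Propositional.Properties as Unique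
open import Data.Maybe.Base using (Maybe; nothing; just; maybe′)
open import Data.Nat.Base as ℕ using (ℕ; NonZero; _≤_; _<_; _+_; _*_; _^_; _∸_; _⊔_; s≤s)
open import Data.Nat.Coprimality using (Coprime; coprime-Bézout; prime⇒coprime)
open import Data.Nat.DivMod using (_%_; _mod_; %-distribˡ-+; [m+n]%n≡m%n; [m+kn]%n≡m%n; m<n⇒m%n≡m)
open import Data.Nat.GCD using (module Bézout)
open import Data.Nat.Primality using (Prime; prime⇒nonZero)
import Data.Nat.Properties as ℕ
open import Data.Nat.Tactic.RingSolver using (solve-∀)
open import Data.Product.Base using (Σ-syntax; ∃-syntax; _×_; _,_; proj₁; proj₂)
open import Data.Sum.Base using (inj₁; inj₂)
open import Data.Unit.Base using (tt)
open import Data.Vec.Base as Vec using ([]; _∷_)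
open import Function.Base using (_∘_)
open import Function.Bundles using (_⇔_; mk⇔; Inverse; Injection)
open import Function.Definitions using (Injective)
open import Function.Properties.Inverse using (↔-sym; ↔⇒↣)
import Relation.Binary.Construct.Closure.Equivalence as EqC
open import Relation.Binary.Definitions using (tri<; tri≈; tri>)
open import Relation.Binary.PropositionalEquality
  using (_≡_; _≢_; refl; sym; trans; cong; cong₂; subst; isEquivalence; module ≡-Reasoning)
open import Relation.Nullary using (¬_; Dec; yes; no; does; contradiction)
open import Relation.Nullary.Decidable
  using (¬?; decidable-stable; dec-true; dec-false; does-⇔)

-- Counting with duplicate-free lists

module _ {A : Set} where

  lookup-injective : ∀ {xs : List A} → Unique xs → ∀ {i j} → lookup xs i ≡ lookup xs j → i ≡ j
  lookup-injective (_ ∷ _) {zero} {zero} _ = refl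
  lookup-injective {x ∷ xs} (x∉ ∷ _) {zero} {suc j} eq =
    contradiction eq (All.lookup x∉ (∈-lookup {xs = xs} j))
  lookup-injective {x ∷ xs} (x∉ ∷ _) {suc i} {zero} eq =
    contradiction (sym eq) (All.lookup x∉ (∈-lookup {xs = xs} i))
  lookup-injective (_ ∷ xs!) {suc i} {suc j} eq = cong suc (lookup-injective xs! eq)

  Unique-⊆⇒length≤ : ∀ {xs ys : List A} → Unique xs → xs ⊆ ys → length xs ≤ length ys
  Unique-⊆⇒length≤ {xs} {ys} xs! xs⊆ys = injective⇒≤ {f = position} λ {i} {j} eq →
    lookup-injective xs! (trans (lookup-index (member i))
      (trans (cong (lookup ys) eq) (sym (lookup-index (member j)))))
    where
    member : ∀ i → lookup xs i ∈ₗ ys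
    member i = xs⊆ys (∈-lookup {xs = xs} i)
    position : Fin (length xs) → Fin (length ys)
    position = Any.index ∘ member

  -- Injectivity is asked only on members of the list: `colour` is far from injective on all labels,
  -- but it is on those missed by a cut.
  Unique-map⁺ : ∀ {B : Set} {f : A → B} {xs} →
    (∀ {x y} → x ∈ₗ xs → y ∈ₗ xs → x ≢ y → f x ≢ f y) → Unique xs → Unique (map f xs)
  Unique-map⁺ inj [] = []
  Unique-map⁺ inj (x∉ ∷ xs!) =
    All-map⁺ (All.tabulate λ y∈ → inj (here refl) (there y∈) (All.lookup x∉ y∈))
    ∷ Unique-map⁺ (λ x∈ y∈ → inj (there x∈) (there y∈)) xs!

length-allFin : ∀ n → length (allFin n) ≡ n
length-allFin n = length-tabulate {n = n} (λ i → i)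

-- Pigeonhole: an absent `i` could be prepended, giving too many distinct elements of `Fin n`.
Unique-full : ∀ {n} {xs : List (Fin n)} → Unique xs → n ≤ length xs → ∀ i → i ∈ₗ xs
Unique-full {n} {xs} xs! n≤ i with DecMembership._∈?_ _≟_ i xs
... | yes i∈ = i∈
... | no  i∉ = contradiction (ℕ.≤-trans (s≤s n≤)
  (subst (ℕ.suc (length xs) ≤_) (length-allFin n)
    (Unique-⊆⇒length≤ (¬Any⇒All¬ xs i∉ ∷ xs!) (λ _ → ∈-allFin _)))) ℕ.1+n≰n

-- Subsets

-- Step edges of `J` are indexed by sets without `i`; this presents any set containing `i` as the
-- far end of one.
∈⇒insert : ∀ {n} {i : Fin n} {S} → i ∈ S → ∃[ T ] i ∉ T × T ∪ ⁅ i ⁆ ≡ S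
∈⇒insert {S = _ ∷ S} Vec.here = outside ∷ S , (λ ()) , cong (inside ∷_) (∪-identityʳ S)
∈⇒insert {S = s ∷ S} (Vec.there i∈) with T , i∉ , eq ← ∈⇒insert i∈ =
  s ∷ T , (λ { (Vec.there p) → i∉ p }) , cong₂ _∷_ (∨-identityʳ s) eq

encode : ∀ {n} → Subset n → Fin (2 ^ n)
encode []      = zero
encode (s ∷ S) = combine (Inverse.from 2↔Bool s) (encode S)

encode-injective : ∀ {n} (S T : Subset n) → encode S ≡ encode T → S ≡ T
encode-injective []      []      _  = refl
encode-injective (s ∷ S) (t ∷ T) eq
  with eq₁ , eq₂ ← combine-injective (Inverse.from 2↔Bool s) (encode S)
                                     (Inverse.from 2↔Bool t) (encode T) eq =
  cong₂ _∷_ (Injection.injective (↔⇒↣ (↔-sym 2↔Bool)) eq₁) (encode-injective S T eq₂)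

-- The sum stays in ℕ and is reduced modulo `ℓ` only at its use, so that inserting an element is an
-- exact equation.
weight : ∀ {n} → (Fin n → ℕ) → Subset n → ℕ
weight w []            = 0
weight w (inside ∷ S)  = w zero + weight (w ∘ suc) S
weight w (outside ∷ S) = weight (w ∘ suc) S

weight-insert : ∀ {n} (w : Fin n → ℕ) S {i} → i ∉ S → weight w (S ∪ ⁅ i ⁆) ≡ weight w S + w i
weight-insert w (inside ∷ S)  {zero}  i∉ = contradiction Vec.here i∉
weight-insert w (outside ∷ S) {zero}  i∉ =
  trans (cong (λ T → w zero + weight (w ∘ suc) T) (∪-identityʳ S)) (ℕ.+-comm (w zero) _)
weight-insert w (inside ∷ S)  {suc i} i∉ =
  trans (cong (w zero +_) (weight-insert (w ∘ suc) S (i∉ ∘ Vec.there)))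
        (sym (ℕ.+-assoc (w zero) _ _))
weight-insert w (outside ∷ S) {suc i} i∉ = weight-insert (w ∘ suc) S (i∉ ∘ Vec.there)

-- Residues

module _ (ℓ : ℕ) .{{_ : NonZero ℓ}} where

  toℕ-mod : ∀ m → toℕ (m mod ℓ) ≡ m % ℓ
  toℕ-mod m = toℕ-fromℕ< _

  %⇒mod : ∀ {m n} → m % ℓ ≡ n % ℓ → m mod ℓ ≡ n mod ℓ
  %⇒mod {m} {n} eq = toℕ-injective (trans (toℕ-mod m) (trans eq (sym (toℕ-mod n))))

  mod⇒% : ∀ {m n} → m mod ℓ ≡ n mod ℓ → m % ℓ ≡ n % ℓ
  mod⇒% {m} {n} eq = trans (sym (toℕ-mod m)) (trans (cong toℕ eq) (toℕ-mod n))

  toℕ-% : (i : Fin ℓ) → toℕ i % ℓ ≡ toℕ i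
  toℕ-% i = m<n⇒m%n≡m (toℕ<n i)

  mod-toℕ : (i : Fin ℓ) → toℕ i mod ℓ ≡ i
  mod-toℕ i = toℕ-injective (trans (toℕ-mod (toℕ i)) (toℕ-% i))

  %-+-cong : ∀ {m n} o → m % ℓ ≡ n % ℓ → (m + o) % ℓ ≡ (n + o) % ℓ
  %-+-cong {m} {n} o eq = trans (%-distribˡ-+ m o ℓ)
    (trans (cong (λ r → (r + o % ℓ) % ℓ) eq) (sym (%-distribˡ-+ n o ℓ)))

  -- Adding `o * pred ℓ` acts as subtracting `o`: together with `o` it makes the multiple `o * ℓ`.
  %-+-cancel : ∀ {m n} o → (m + o) % ℓ ≡ (n + o) % ℓ → m % ℓ ≡ n % ℓ
  %-+-cancel {m} {n} o eq =
    trans (sym (complete m)) (trans (%-+-cong (o * ℕ.pred ℓ) eq) (complete n))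
    where
    complete : ∀ m → (m + o + o * ℕ.pred ℓ) % ℓ ≡ m % ℓ
    complete m = trans (cong (_% ℓ) (begin
        m + o + o * ℕ.pred ℓ     ≡⟨ ℕ.+-assoc m o _ ⟩
        m + (o + o * ℕ.pred ℓ)   ≡⟨ cong (m +_) (sym (ℕ.*-suc o (ℕ.pred ℓ))) ⟩
        m + o * ℕ.suc (ℕ.pred ℓ) ≡⟨ cong (λ r → m + o * r) (ℕ.suc-pred ℓ) ⟩
        m + o * ℓ                ∎))
      ([m+kn]%n≡m%n m o ℓ)
      where open ≡-Reasoning

-- Periodic functions on the natural numbers

module _ {A : Set} (f : ℕ → A) where

  Period : ℕ → Set
  Period d = ∀ n → f (n + d) ≡ f n

  period-* : ∀ {d} → Period d → ∀ x → Period (x * d)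
  period-* p ℕ.zero    n = cong f (ℕ.+-identityʳ n)
  period-* {d} p (ℕ.suc x) n =
    trans (cong f (sym (ℕ.+-assoc n d (x * d)))) (trans (period-* p x (n + d)) (p n))

  -- Bézout writes 1 as a difference of multiples of `m` and `n`; the subtracted multiple is moved
  -- to the other side, which avoids negative shifts.
  coprime-periods⇒1 : ∀ {m n} → Coprime m n → Period m → Period n → Period 1
  coprime-periods⇒1 {m} {n} c pm pn r with coprime-Bézout c
  ... | Bézout.+- x y eq = trans (sym (period-* pn y (r + 1)))
        (trans (cong f (trans (ℕ.+-assoc r 1 (y * n)) (cong (r +_) eq))) (period-* pm x r))
  ... | Bézout.-+ x y eq = trans (sym (period-* pm x (r + 1)))
        (trans (cong f (trans (ℕ.+-assoc r 1 (x * m)) (cong (r +_) eq))) (period-* pn y r))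

  period-1⇒constant : Period 1 → ∀ n → f n ≡ f 0
  period-1⇒constant p n = trans (cong f (sym (ℕ.*-identityʳ n))) (period-* p n 0)

  -- With `ℓ = a + e`, a further shift by `e` completes the common shift `a` to a full period,
  -- leaving `d`.
  shifts⇒period : ∀ {ℓ a d} → a ≤ ℓ → Period ℓ →
                  (∀ n → f (n + a) ≡ f (n + (a + d))) → Period d
  shifts⇒period {a = a} {d} a≤ℓ p s n with e , refl ← ℕ.m≤n⇒∃[o]m+o≡n a≤ℓ = begin
    f (n + d)             ≡⟨ sym (p (n + d)) ⟩
    f (n + d + (a + e))   ≡⟨ cong f (rearrange n d a e) ⟩
    f (n + e + (a + d))   ≡⟨ sym (s (n + e)) ⟩
    f (n + e + a)         ≡⟨ cong f (rearrange′ n e a) ⟩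
    f (n + (a + e))       ≡⟨ p n ⟩
    f n                   ∎
    where
    open ≡-Reasoning
    rearrange : ∀ n d a e → n + d + (a + e) ≡ n + e + (a + d)
    rearrange = solve-∀
    rearrange′ : ∀ n e a → n + e + a ≡ n + (a + e)
    rearrange′ = solve-∀

  shifts-<⇒constant : ∀ {ℓ a b} → Prime ℓ → a < b → b < ℓ → Period ℓ →
                      (∀ n → f (n + a) ≡ f (n + b)) → ∀ n → f n ≡ f 0
  shifts-<⇒constant {ℓ} {a} ℓ-prime a<b b<ℓ p s with o , refl ← ℕ.m≤n⇒∃[o]m+o≡n a<b =
    -- The larger shift is now `suc (a + o)`, so the two differ by `suc o`, which is positive and
    -- below the prime `ℓ`, hence coprime to it.
    period-1⇒constant (coprime-periods⇒1
      (prime⇒coprime ℓ-prime (ℕ.≤-<-trans (s≤s (ℕ.m≤n+m o a)) b<ℓ))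
      p (shifts⇒period (ℕ.<⇒≤ (ℕ.<-trans a<b b<ℓ)) p
          (λ n → trans (s n) (cong (λ r → f (n + r)) (sym (ℕ.+-suc a o))))))

  shifts⇒constant : ∀ {ℓ a b} → Prime ℓ → a < ℓ → b < ℓ → a ≢ b → Period ℓ →
                    (∀ n → f (n + a) ≡ f (n + b)) → ∀ n → f n ≡ f 0
  shifts⇒constant {a = a} {b} ℓ-prime a<ℓ b<ℓ a≢b p s with ℕ.<-cmp a b
  ... | tri< a<b _ _ = shifts-<⇒constant ℓ-prime a<b b<ℓ p s
  ... | tri≈ _ a≡b _ = contradiction a≡b a≢b
  ... | tri> _ _ b<a = shifts-<⇒constant ℓ-prime b<a a<ℓ p (sym ∘ s)

-- Cuts that respect a partition

module _ {W : Set} where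

  Respects : (W → Bool) → Partition W → Set
  Respects f P = ∀ {u v} → Same P u v → f u ≡ f v

  EdgeInvariant : (W → Bool) → Graph W → Set
  EdgeInvariant f H = ∀ e → f (proj₁ (ends e)) ≡ f (proj₂ (ends e))
    where open Graph H

  invariant⇒respects : ∀ {f} H → EdgeInvariant f H → Respects f (cc H)
  invariant⇒respects {f} H inv =
    EqC.gfold isEquivalence f λ { (e , refl) → inv e }

  respects⇒invariant : ∀ {f} H → Respects f (cc H) → EdgeInvariant f H
  respects⇒invariant H r e = r (EqC.return (e , refl))

  respects-∨ : ∀ {f P Q} → Respects f P → Respects f Q → Respects f (P ∨ Q)
  respects-∨ {f} r s = EqC.gfold isEquivalence f λ { (inj₁ p) → r p ; (inj₂ q) → s q }

-- Slices and products of cuts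

module _ {A B : Set} (S : Maybe (A × B) → Bool) where

  sliceX : B → Maybe A → Bool
  sliceX y = maybe′ (λ x → S (just (x , y))) (S nothing)

  sliceY : A → Maybe B → Bool
  sliceY x = maybe′ (λ y → S (just (x , y))) (S nothing)

  -- The slice takes the value `S nothing` at the basepoint because z₀ stands for the collapsed
  -- basepoint: `base` handles pairs involving it, `copy` all others.
  respects-sliceX : ∀ {α} → Respects S (LX α) → ∀ y → Respects (sliceX y) α
  respects-sliceX {α} r y {nothing} {nothing} _ = refl
  respects-sliceX {α} r y {nothing} {just _}  p = r (base tt (Partition.~-sym α p))
  respects-sliceX {α} r y {just _}  {nothing} p = r (base p tt)
  respects-sliceX {α} r y {just _}  {just _}  p = r (copy p)

  respects-sliceY : ∀ {β} → Respects S (LY β) → ∀ x → Respects (sliceY x) β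
  respects-sliceY {β} r x {nothing} {nothing} _ = refl
  respects-sliceY {β} r x {nothing} {just _}  p = r (base tt (Partition.~-sym β p))
  respects-sliceY {β} r x {just _}  {nothing} p = r (base p tt)
  respects-sliceY {β} r x {just _}  {just _}  p = r (copy p)

module _ {A B : Set} (f : A → Bool) (g : B → Bool) where

  productCut : Maybe (A × B) → Bool
  productCut = maybe′ (λ { (x , y) → f x ∧ g y }) false

  -- On the block of z₀ the first factor is false, as at the basepoint; inside a copy the second
  -- factor is fixed.
  productCut-LX : ∀ {α} → Respects (maybe′ f false) α → Respects productCut (LX α)
  productCut-LX {α} r (base {z} {z′} p q) = trans (off z p) (sym (off z′ q))
    where
    off : ∀ z → BaseX α z → productCut z ≡ false
    off nothing      _ = refl
    off (just (x , y)) p = cong (_∧ g y) (r p)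
  productCut-LX r (copy {y = y} p) = cong (_∧ g y) (r p)

  productCut-LY : ∀ {β} → Respects (maybe′ g false) β → Respects productCut (LY β)
  productCut-LY {β} r (base {z} {z′} p q) = trans (off z p) (sym (off z′ q))
    where
    off : ∀ z → BaseY β z → productCut z ≡ false
    off nothing      _ = refl
    off (just (x , y)) p = trans (cong (f x ∧_) (r p)) (∧-zeroʳ (f x))
  productCut-LY r (copy {x = x} p) = cong (f x ∧_) (r p)

-- Cuts compatible with the label graphs

module Slices {k q ℓ : ℕ} (G : BalancedMulticolored k q) .{{_ : NonZero ℓ}}
              (α : Fin q → Fin ℓ) where
  open BalancedMulticolored G
  open Construction G ℓ α

  a-injective : ∀ {i} {u v : V i} → a (i , u) ≡ a (i , v) → u ≡ v
  a-injective {i} = Injection.injective (↔⇒↣ (index i))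

  -- For `i ∉ S` the two labels send `(S , n)` to points over `S ∪ ⁅ i ⁆` whose residues differ by a
  -- fixed nonzero amount, so `g` is constant there. The spoke at that set ties the constant to the
  -- basepoint, and one step brings in the sets without `i`.
  twoLabels⇒constant : Prime ℓ → Injective _≡_ _≡_ α → (g : X → Bool) →
    ∀ {l m} → colour l ≡ colour m → l ≢ m → EdgeInvariant g (J l) → EdgeInvariant g (J m) →
    ∀ x → g x ≡ g nothing
  twoLabels⇒constant ℓ-prime α-inj g {i , u} {.i , v} refl l≢m gl gm = constant
    where
    αu≢αv : toℕ (α (a (i , u))) ≢ toℕ (α (a (i , v)))
    αu≢αv eq = l≢m (cong (i ,_) (a-injective (α-inj (toℕ-injective eq))))

    -- Restated over ℕ, so that the results on periodic functions apply after composing with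
    -- `_mod ℓ`.
    step-mod : ∀ {u S} → EdgeInvariant g (J (i , u)) → i ∉ S → ∀ n →
      g (just (S , n mod ℓ)) ≡ g (just (S ∪ ⁅ i ⁆ , (n + toℕ (α (a (i , u)))) mod ℓ))
    step-mod {u} {S} inv i∉ n = trans (inv (step S i∉ (n mod ℓ)))
      (cong (λ r → g (just (S ∪ ⁅ i ⁆ , r)))
        (%⇒mod ℓ (%-+-cong ℓ (toℕ (α (a (i , u))))
          (trans (toℕ-% ℓ (n mod ℓ)) (toℕ-mod ℓ n)))))

    with-i : ∀ {S} → i ∉ S → ∀ r → g (just (S ∪ ⁅ i ⁆ , r)) ≡ g nothing
    with-i {S} i∉ r = trans (cong ψ′ (sym (mod-toℕ ℓ r)))
      (trans (shifts⇒constant ψ ℓ-prime (toℕ<n _) (toℕ<n _) αu≢αv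
               (λ n → cong ψ′ (%⇒mod ℓ ([m+n]%n≡m%n n ℓ)))
               (λ n → trans (sym (step-mod gl i∉ n)) (step-mod gm i∉ n)) (toℕ r))
             (sym (gl (spoke (S ∪ ⁅ i ⁆)))))
      where
      ψ′ : Fin ℓ → Bool
      ψ′ r = g (just (S ∪ ⁅ i ⁆ , r))
      ψ : ℕ → Bool
      ψ n = ψ′ (n mod ℓ)

    constant : ∀ x → g x ≡ g nothing
    constant nothing = refl
    constant (just (S , r)) with i ∈? S
    ... | no  i∉ = trans (gl (step S i∉ r)) (with-i i∉ _)
    ... | yes i∈ with T , i∉ , refl ← ∈⇒insert i∈ = with-i i∉ r

  -- For z_uv with v not selected, the edge from s is an `other` edge of the
  -- selected vertex of the same colour as v.
  nonadjacent⇒constant : (x : ∀ i → V i) (h : Y → Bool) →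
    (∀ i → EdgeInvariant h (Q (i , x i))) →
    ∀ {i j} → i Fin.< j → ¬ Adj (i , x i) (j , x j) → ∀ y → h y ≡ h nothing
  nonadjacent⇒constant x h inv {i} {j} i<j ¬adj = constant
    where
    n₀ : NonEdge
    n₀ = nonEdge (i , x i) (j , x j) i<j ¬adj

    at-t : h (just t) ≡ h nothing
    at-t = trans (sym (inv j (second n₀ refl))) (sym (inv i (first n₀ refl)))

    constant : ∀ y → h y ≡ h nothing
    constant nothing  = refl
    constant (just t) = at-t
    constant (just (z n@(nonEdge u (c , v) _ _))) with a (c , v) ≟ a (c , x c)
    ... | yes eq = trans (inv c (second n (cong (c ,_) (a-injective eq)))) at-t
    ... | no  v≢ = sym (inv c (other n refl (v≢ ∘ cong a)))

  module _ (x : ∀ i → V i) where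

    shift : Fin k → ℕ
    shift i = toℕ (α (a (i , x i)))

    -- Encodes that `r` minus the weight of `S` equals `c`, with the subtraction moved across.
    value? : ∀ c S (r : Fin ℓ) → Dec (r ≡ (toℕ {ℓ} c + weight shift S) mod ℓ)
    value? c S r = r ≟ _

    -- A value is taken when some spoke end `(S , 0ₗ)` has it. Since `S` determines the value by
    -- cancellation, choosing a witness for every `c` would embed `Fin ℓ` into `Fin (2 ^ k)`.
    avoidedValue : 2 ^ k < ℓ → ∃[ c ] ∀ S → 0ₗ ≢ (toℕ {ℓ} c + weight shift S) mod ℓ
    avoidedValue 2^k<ℓ = proj₁ found , λ S eq → proj₂ found (S , eq)
      where
      Taken : Fin ℓ → Set
      Taken c = ∃[ S ] 0ₗ ≡ (toℕ c + weight shift S) mod ℓ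
      taken? : ∀ c → Dec (Taken c)
      taken? c = anySubset? (λ S → value? c S 0ₗ)
      not-all : ¬ (∀ c → Taken c)
      not-all all = ℕ.<⇒≱ 2^k<ℓ (injective⇒≤ {f = encode ∘ proj₁ ∘ all} λ {c} {d} eq →
        let eq′ = encode-injective (proj₁ (all c)) (proj₁ (all d)) eq in
        toℕ-injective (trans (sym (toℕ-% ℓ c)) (trans
          (%-+-cancel ℓ (weight shift (proj₁ (all c)))
            (mod⇒% ℓ (trans (sym (proj₂ (all c))) (trans (proj₂ (all d))
              (cong (λ S → (toℕ d + weight shift S) mod ℓ) (sym eq′))))))
          (toℕ-% ℓ d))))
      found : ∃[ c ] ¬ Taken c
      found = ¬∀⟶∃¬ ℓ Taken taken? not-all

    levelSet : Fin ℓ → X° → Bool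
    levelSet c (S , r) = does (value? c S r)

    -- Spoke ends stay off the level set since `c` is avoided. A step adds the same shift to both
    -- sides of the level equation, and cancellation gives the converse.
    levelSet-invariant : ∀ {c} → (∀ S → 0ₗ ≢ (toℕ c + weight shift S) mod ℓ) →
      ∀ i → EdgeInvariant (maybe′ (levelSet c) false) (J (i , x i))
    levelSet-invariant {c} c-avoided i (spoke S) = sym (dec-false (value? c S 0ₗ) (c-avoided S))
    levelSet-invariant {c} c-avoided i (step S i∉ r) =
      does-⇔ (mk⇔ to from) (value? c S r) (value? c (S ∪ ⁅ i ⁆) (r +ₗ α (a (i , x i))))
      where
      i∉S : i ∉ S
      -- The proof stored in the edge is irrelevant; it may be used here because only a
      -- contradiction is wanted.
      i∉S i∈ = ⊥-elim-irr (i∉ i∈)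
      target : toℕ c + weight shift (S ∪ ⁅ i ⁆) ≡ toℕ c + weight shift S + shift i
      target = trans (cong (toℕ c +_) (weight-insert shift S i∉S))
                     (sym (ℕ.+-assoc (toℕ c) _ _))
      to : r ≡ (toℕ c + weight shift S) mod ℓ →
           r +ₗ α (a (i , x i)) ≡ (toℕ c + weight shift (S ∪ ⁅ i ⁆)) mod ℓ
      to eq = trans (%⇒mod ℓ (%-+-cong ℓ (shift i) (mod⇒% ℓ (trans (mod-toℕ ℓ r) eq))))
                    (cong (_mod ℓ) (sym target))
      from : r +ₗ α (a (i , x i)) ≡ (toℕ c + weight shift (S ∪ ⁅ i ⁆)) mod ℓ →
             r ≡ (toℕ c + weight shift S) mod ℓ
      from eq = trans (sym (mod-toℕ ℓ r))
        (%⇒mod ℓ (%-+-cancel ℓ (shift i) (mod⇒% ℓ (trans eq (cong (_mod ℓ) target)))))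

    -- Colour classes come with no equality test, so selection is decided on indices.
    selected? : ∀ v → Dec (a v ≡ a (colour v , x (colour v)))
    selected? v = _ ≟ _

    selected⇒≡ : ∀ v → a v ≡ a (colour v , x (colour v)) → v ≡ (colour v , x (colour v))
    selected⇒≡ (c , v) eq = cong (c ,_) (a-injective eq)

    side-t : Y° → Bool
    side-t t     = true
    side-t (z n) = does (selected? (NonEdge.v n))

    -- For `first`, a selected `v` would be adjacent to the selected `u`. For `second`, `v` is
    -- itself selected, so both ends lie on the side of `t`. For `other`, the vertex selected in the
    -- colour of `v` is not `v`.
    side-t-invariant : (∀ i j → i ≢ j → Adj (i , x i) (j , x j)) →
      ∀ i → EdgeInvariant (maybe′ side-t false) (Q (i , x i))
    side-t-invariant clique i (first n@(nonEdge _ v i<c ¬adj) refl) =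
      sym (dec-false (selected? v) λ eq → ⊥-elim-irr (¬adj
        (subst (Adj (i , x i)) (sym (selected⇒≡ v eq))
          (clique i (colour v) λ i≡c → ⊥-elim-irr (Fin.<⇒≢ i<c i≡c)))))
    side-t-invariant clique i (second (nonEdge _ v _ _) refl) = dec-true (selected? v) refl
    side-t-invariant clique i (other (nonEdge _ v _ _) refl v≢) =
      sym (dec-false (selected? v) (v≢ ∘ selected⇒≡ v))

-- Counting missed labels, and the two directions

module Reduction {k q ℓ : ℕ} (G : BalancedMulticolored k q) (ℓ-prime : Prime ℓ)
                 (α : Fin q → Fin ℓ) where
  open BalancedMulticolored G
  private instance
    ℓ-nonZero : NonZero ℓ
    ℓ-nonZero = prime⇒nonZero ℓ-prime
  open Construction G ℓ α
  open Slices G α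

  labelList : List Vertex
  labelList = proj₁ vertex-finite

  labelList-unique : Unique labelList
  labelList-unique = Unique.map⁺ (Injection.injective (↔⇒↣ (↔-sym vertex↔))) (Unique.allFin⁺ (k * q))

  length-labelList : length labelList ≡ k * q
  length-labelList = trans (length-map (Inverse.from vertex↔) (allFin (k * q))) (length-allFin (k * q))

  module _ (H : ∀ l → SpanningForest (P l)) where
    private module H l = SpanningForest (H l)

    I : GlobalLabelMinCut
    I = instanceOf H

    module _ (S : Z → Bool) where

      occurs⇒¬respects : ∀ {l} → OccursOnCut I S l → ¬ Respects S (P l)
      occurs⇒¬respects ((l , e) , refl , crossing) r = crossing (r (H.within l e))

      CrossingEdge : ∀ l → H.Edge l → Set
      CrossingEdge l e = S (proj₁ (H.ends l e)) ≢ S (proj₂ (H.ends l e))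

      -- A decidable form of `OccursOnCut`, by searching the finite edge list of a single label
      -- graph.
      occurs? : ∀ l → Dec (Any (CrossingEdge l) (proj₁ (H.finite l)))
      occurs? l = any? (λ e → ¬? (_ ≟ᵇ _)) _

      -- Two points of a block are joined by a walk in the forest, none of whose edges crosses the
      -- cut.
      missed⇒respects : ∀ {l} → ¬ Any (CrossingEdge l) (proj₁ (H.finite l)) → Respects S (P l)
      missed⇒respects {l} ¬any p = invariant⇒respects (H.graph l)
        (λ e → decidable-stable (_ ≟ᵇ _) λ crossing →
          ¬any (lose (proj₂ (H.finite l) e) crossing))
        (H.connected l p)

      missed : List Vertex
      missed = filter (λ l → ¬? (occurs? l)) labelList

      k≤length-missed : 1 ≤ q → AtMost (k * q ∸ k) (OccursOnCut I S) → k ≤ length missed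
      k≤length-missed 1≤q bound = ℕ.+-cancelˡ-≤ (k * q ∸ k) k (length missed) (begin
        -- The truncated subtraction is exact here because `1≤q` gives `k≤kq`.
        k * q ∸ k + k                   ≡⟨ ℕ.m∸n+n≡m k≤kq ⟩
        k * q                           ≡⟨ sym length-labelList ⟩
        length labelList                ≤⟨ Unique-⊆⇒length≤ labelList-unique split ⟩
        length (occurring ++ missed)    ≡⟨ length-++ occurring ⟩
        length occurring + length missed ≤⟨ ℕ.+-monoˡ-≤ (length missed)
             (bound occurring (Unique.filter⁺ occurs? labelList-unique)
               (All.map occurrence (all-filter occurs? labelList))) ⟩
        k * q ∸ k + length missed       ∎)
        where
        open ℕ.≤-Reasoning
        occurring : List Vertex
        occurring = filter occurs? labelList
        k≤kq : k ≤ k * q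
        k≤kq = subst (_≤ k * q) (ℕ.*-identityʳ k) (ℕ.*-monoʳ-≤ k 1≤q)
        occurrence : ∀ {l} → Any (CrossingEdge l) (proj₁ (H.finite l)) → OccursOnCut I S l
        occurrence {l} any with e , crossing ← satisfied any = (l , e) , refl , crossing
        split : labelList ⊆ occurring ++ missed
        split {l} l∈ with occurs? l
        ... | yes o = ∈-++⁺ˡ (∈-filter⁺ occurs? l∈ o)
        ... | no ¬o = ∈-++⁺ʳ occurring (∈-filter⁺ (λ l → ¬? (occurs? l)) l∈ ¬o)

    cut⇒clique : 1 ≤ q → Injective _≡_ _≡_ α → IsYesCut I → IsYesClique G
    cut⇒clique 1≤q α-inj (S , (v₁ , v₁∈) , (v₀ , v₀∉) , bound) = selection , clique
      where
      -- Both values of `S` occur, so one of the two given points disagrees with z₀ and is therefore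
      -- a genuine pair.
      offBase : ∃[ p ] S (just p) ≢ S nothing
      offBase = separate v₁ v₁∈ v₀ v₀∉
        where
        separate : ∀ v → S v ≡ true → ∀ w → S w ≡ false → ∃[ p ] S (just p) ≢ S nothing
        separate v v∈ w w∉ with S nothing in eq
        separate nothing  v∈ w        w∉ | false = contradiction (trans (sym v∈) eq) λ ()
        separate (just p) v∈ w        w∉ | false = p , λ e → contradiction (trans (sym v∈) e) λ ()
        separate v        v∈ nothing  w∉ | true  = contradiction (trans (sym w∉) eq) λ ()
        separate v        v∈ (just p) w∉ | true  = p , λ e → contradiction (trans (sym w∉) e) λ ()

      x₀ : X°
      x₀ = proj₁ (proj₁ offBase)
      y₀ : Y°
      y₀ = proj₂ (proj₁ offBase)

      Λ : List Vertex
      Λ = missed S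

      respects : ∀ {l} → l ∈ₗ Λ → Respects S (P l)
      respects l∈ = missed⇒respects S
        (proj₂ (∈-filter⁻ (λ l → ¬? (occurs? S l)) {xs = labelList} l∈))

      respectsJ : ∀ {l} → l ∈ₗ Λ → EdgeInvariant (sliceX S y₀) (J l)
      respectsJ {l} l∈ = respects⇒invariant (J l)
        (respects-sliceX S {E l} (λ p → respects l∈ (EqC.return (inj₁ p))) y₀)

      respectsQ : ∀ {l} → l ∈ₗ Λ → EdgeInvariant (sliceY S x₀) (Q l)
      respectsQ {l} l∈ = respects⇒invariant (Q l)
        (respects-sliceY S {R l} (λ p → respects l∈ (EqC.return (inj₂ p))) x₀)

      colours-unique : Unique (map colour Λ)
      colours-unique = Unique-map⁺
        (λ l∈ m∈ l≢m same → proj₂ offBase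
          (twoLabels⇒constant ℓ-prime α-inj (sliceX S y₀) same l≢m
            (respectsJ l∈) (respectsJ m∈) (just x₀)))
        (Unique.filter⁺ (λ l → ¬? (occurs? S l)) labelList-unique)

      -- At least `k` distinct colours out of `k` leave none out.
      missedOfColour : ∀ i → Σ[ u ∈ V i ] (i , u) ∈ₗ Λ
      missedOfColour i with ∈-map⁻ colour (Unique-full colours-unique
        (subst (k ≤_) (sym (length-map colour Λ)) (k≤length-missed S 1≤q bound)) i)
      ... | (_ , u) , u∈ , refl = u , u∈

      selection : ∀ i → V i
      selection = proj₁ ∘ missedOfColour

      adjacent-< : ∀ {i j} → i Fin.< j → Adj (i , selection i) (j , selection j)
      adjacent-< i<j = decidable-stable (adj? _ _) λ ¬adj → proj₂ offBase
        (nonadjacent⇒constant selection (sliceY S x₀) (respectsQ ∘ proj₂ ∘ missedOfColour)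
          i<j ¬adj (just y₀))

      clique : ∀ i j → i ≢ j → Adj (i , selection i) (j , selection j)
      clique i j i≢j with Fin.<-cmp i j
      ... | tri< i<j _ _ = adjacent-< i<j
      ... | tri≈ _ i≡j _ = contradiction i≡j i≢j
      ... | tri> _ _ j<i = adj-sym (adjacent-< j<i)

    clique⇒cut : 2 ^ k < ℓ → IsYesClique G → IsYesCut I
    clique⇒cut 2^k<ℓ (x , clique) = S , (inS , inS-true) , (nothing , refl) , bound
      where
      c : Fin ℓ
      c = proj₁ (avoidedValue x 2^k<ℓ)
      S : Z → Bool
      S = productCut (levelSet x c) (side-t x)
      inS : Z
      -- The residue is chosen to satisfy the level equation over `∅` by reflexivity, and `t` is
      -- always on the true side.
      inS = just ((∅ , (toℕ c + weight (shift x) ∅) mod ℓ) , t)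
      inS-true : S inS ≡ true
      inS-true = cong (_∧ true) (dec-true (value? x c ∅ _) refl)

      respects : ∀ i → Respects S (P (i , x i))
      respects i = respects-∨ {P = LX (E (i , x i))} {Q = LY (R (i , x i))}
        (productCut-LX _ _ {E (i , x i)} (invariant⇒respects (J (i , x i))
          (levelSet-invariant x (proj₂ (avoidedValue x 2^k<ℓ)) i)))
        (productCut-LY _ _ {R (i , x i)} (invariant⇒respects (Q (i , x i))
          (side-t-invariant x clique i)))

      selected : List Vertex
      selected = map (λ i → i , x i) (allFin k)

      -- Labels occurring on the cut are disjoint from the `k` selected ones, and there are only
      -- `k * q` labels in all.
      bound : AtMost (k * q ∸ k) (OccursOnCut I S)
      bound ls ls! occ = ℕ.m+n≤o⇒m≤o∸n (length ls) (begin
        length ls + k               ≡⟨ cong (length ls +_) (sym length-selected) ⟩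
        length ls + length selected ≡⟨ sym (length-++ ls) ⟩
        length (ls ++ selected)     ≤⟨ Unique-⊆⇒length≤ (Unique.++⁺ ls! selected! disjoint)
                                         (λ _ → proj₂ vertex-finite _) ⟩
        length labelList            ≡⟨ length-labelList ⟩
        k * q                       ∎)
        where
        open ℕ.≤-Reasoning
        length-selected : length selected ≡ k
        length-selected = trans (length-map _ (allFin k)) (length-allFin k)
        selected! : Unique selected
        selected! = Unique.map⁺ (cong colour) (Unique.allFin⁺ k)
        disjoint : ∀ {l} → ¬ (l ∈ₗ ls × l ∈ₗ selected)
        disjoint (l∈ls , l∈sel) with i , _ , refl ← ∈-map⁻ _ l∈sel =
          occurs⇒¬respects S (All.lookup occ l∈ls) (respects i)

corollary5p3 : (k q : ℕ) → 1 ≤ k → 1 ≤ q →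
    (G : BalancedMulticolored k q) →
    (ℓ : ℕ) (ℓ-prime : Prime ℓ) →
    q ⊔ 2 ^ k < ℓ → ℓ < 2 * (q ⊔ 2 ^ k) →
    (α : Fin q → Fin ℓ) → Injective _≡_ _≡_ α →
    let open Construction G ℓ {{prime⇒nonZero ℓ-prime}} α in
    (H : ∀ l → SpanningForest (P l)) →
    IsYesCut (instanceOf H) ⇔ IsYesClique G
corollary5p3 k q _ 1≤q G ℓ ℓ-prime M₀<ℓ _ α α-inj H = mk⇔
  (cut⇒clique H 1≤q α-inj)
  (clique⇒cut H (ℕ.≤-<-trans (ℕ.m≤n⊔m q (2 ^ k)) M₀<ℓ))
  where open Reduction G ℓ-prime α
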